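{- Let $G=(X,E)$ be a connected $P_4$-free graph of any cardinality. Then there exists $x\in X$ such that $N_x\neq\emptyset$ if and only if the complement graph $\overline{G}$ is not connected.
   Context: Graphs are undirected, simple, without loops, and not necessarily finite: $G=(X,E)$ with $E\subseteq [X]^2$, the set of $2$-element subsets of $X$. The complement $\overline{G}$ has vertex set $X$ and edge set $[X]^2\setminus E$. $P_4$ is the path on four vertices $1,2,3,4$ with edges $\{1,2\},\{2,3\},\{3,4\}$; a graph is $P_4$-free if it has no induced subgraph isomorphic to $P_4$. For $x\in X$, let $N(x):=\{y\in X:\{x,y\}\in E\}$ and $\mathrm{inc}(x):=X\setminus(N(x)\cup\{x\})$, and define $$N_x:=\{y\in N(x): y\text{ is adjacent to all elements of }\mathrm{inc}(x)\}.$$ -}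

module Defs where

open import Data.Fin.Base using (Fin)
open import Data.Fin.Patterns using (0F; 1F; 2F; 3F)
open import Data.Product.Base using (_×_; _,_)
open import Data.Refinement.Base using (Refinement; value)
open import Function.Base using (_∘_; _on_)
open import Function.Bundles using (_↔_; _⇔_; Inverse)
open import Level using (Level; 0ℓ; suc; _⊔_)
open import Relation.Binary.Construct.Closure.ReflexiveTransitive using (Star)
open import Relation.Binary.Construct.Closure.Symmetric using (SymClosure; fwd; bwd; symmetric)
open import Relation.Binary.Core using (Rel)
open import Relation.Binary.Definitions using (Symmetric; Irreflexive)
open import Relation.Binary.PropositionalEquality using (_≡_; _≢_; refl; sym; cong)
open import Relation.Nullary.Negation using (¬_)
open import Relation.Unary using (Pred; _∈_; ∁; _∪_; ｛_｝)

private
  variable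
    a b p ℓ ℓ′ : Level

-- A set of 2-element subsets of Vertex is a symmetric irreflexive relation.
record Graph (a ℓ : Level) : Set (suc (a ⊔ ℓ)) where
  field
    Vertex : Set a
    Edge   : Rel Vertex ℓ
    symm   : Symmetric Edge
    irrefl : Irreflexive _≡_ Edge

open Graph public

complement : Graph a ℓ → Graph a (a ⊔ ℓ)
complement G = record
  { Vertex = Vertex G
  ; Edge   = λ x y → x ≢ y × ¬ Edge G x y
  ; symm   = λ (x≢y , ¬xy) → (x≢y ∘ sym) , (¬xy ∘ symm G)
  ; irrefl = λ x≡y (x≢y , _) → x≢y x≡y
  }

-- Star (Edge G) x y is the type of finite walks from x to y.
Connected : Graph a ℓ → Set (a ⊔ ℓ)
Connected G = ∀ x y → Star (Edge G) x y

-- The membership proof in a Refinement is irrelevant, so the vertices are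
-- exactly the elements of A, without multiplicity.
induced : (G : Graph a ℓ) → Pred (Vertex G) p → Graph (a ⊔ p) ℓ
induced G A = record
  { Vertex = Refinement (Vertex G) A
  ; Edge   = Edge G on value
  ; symm   = symm G
  ; irrefl = irrefl G ∘ cong value
  }

record _≅_ (G : Graph a ℓ) (H : Graph b ℓ′) : Set (a ⊔ b ⊔ ℓ ⊔ ℓ′) where
  field
    bijection : Vertex G ↔ Vertex H
    edges     : ∀ x y → Edge G x y ⇔ Edge H (Inverse.to bijection x) (Inverse.to bijection y)

data P₄-Step : Rel (Fin 4) 0ℓ where
  step₁₂ : P₄-Step 0F 1F
  step₂₃ : P₄-Step 1F 2F
  step₃₄ : P₄-Step 2F 3F

P₄ : Graph 0ℓ 0ℓ
P₄ = record
  { Vertex = Fin 4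
  ; Edge   = SymClosure P₄-Step
  ; symm   = symmetric P₄-Step
  ; irrefl = λ { refl (fwd ()) ; refl (bwd ()) }
  }

P₄-Free : Graph a ℓ → Set (suc a ⊔ ℓ)
P₄-Free {a} G = (A : Pred (Vertex G) a) → ¬ (P₄ ≅ induced G A)

N : (G : Graph a ℓ) → Vertex G → Pred (Vertex G) ℓ
N G x = λ y → Edge G x y

inc : (G : Graph a ℓ) → Vertex G → Pred (Vertex G) (a ⊔ ℓ)
inc G x = ∁ (N G x ∪ ｛ x ｝)

Nₓ : (G : Graph a ℓ) → Vertex G → Pred (Vertex G) (a ⊔ ℓ)
Nₓ G x = λ y → y ∈ N G x × (∀ z → z ∈ inc G x → Edge G y z)

{-# OPTIONS --safe #-}

-- A complement-neighbour of x is an element of inc(x), so y ∈ N_x says exactly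
-- that y is at distance greater than 2 from x in the complement. P₄ is
-- self-complementary, hence a connected component of the complement of a
-- P₄-free graph has diameter at most 2, and such a y is not reachable from x
-- in the complement at all.
module Submission where

open import Defs
open import Axiom.ExcludedMiddle using (ExcludedMiddle)
open import Data.Fin.Patterns using (0F; 1F; 2F; 3F)
open import Data.Irrelevant using ([_])
open import Data.Product.Base using (∃-syntax; _×_; _,_; proj₁; proj₂)
open import Data.Refinement.Base using (Refinement; _,_; value)
open import Data.Sum.Base using (inj₁; inj₂)
open import Function.Base using (_∘_)
open import Function.Bundles using (_⇔_; mk⇔; mk↔ₛ′)
open import Function.Definitions using (Injective)
open import Level using (Level; _⊔_; Lift; lift; lower)
open import Relation.Binary.Construct.Closure.ReflexiveTransitive using (Star; ε; _◅_)
open import Relation.Binary.Construct.Closure.Symmetric using (fwd; bwd)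
open import Relation.Binary.Definitions using (Decidable)
open import Relation.Binary.PropositionalEquality using (_≡_; refl; sym)
open import Relation.Nullary.Decidable using (map′; recompute; decidable-stable; yes; no)
open import Relation.Nullary.Negation using (¬_; contradiction)
open import Relation.Unary using (Pred; Satisfiable) renaming (Decidable to Decidable₁)

private
  variable
    a b ℓ ℓ′ : Level

lower-em : ∀ a ℓ → ExcludedMiddle (a ⊔ ℓ) → ExcludedMiddle ℓ
lower-em a ℓ em = map′ lower lift (em {Lift a _})

Range : {A : Set a} {B : Set b} → (A → B) → Pred B (a ⊔ b)
Range f y = ∃[ x ] f x ≡ y

value-injective : ∀ {p} {A : Set a} {P : Pred A p} {u v : Refinement A P} →
                  value u ≡ value v → u ≡ v
value-injective refl = refl

-- A vertex of the induced graph carries only an irrelevant proof of lying in the range.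
-- Decidability of the range lets `recompute` turn it into an actual preimage, which defines the
-- inverse of the bijection.
embedding⇒≅induced : (H : Graph b ℓ′) (G : Graph a ℓ) (f : Vertex H → Vertex G) →
  Decidable₁ (Range f) → Injective _≡_ _≡_ f →
  (∀ i j → Edge H i j ⇔ Edge G (f i) (f j)) → H ≅ induced G (Range f)
embedding⇒≅induced H G f range? f-injective f-edges = record
  { bijection = mk↔ₛ′ (λ i → f i , [ i , refl ]) (proj₁ ∘ preimage)
      (value-injective ∘ proj₂ ∘ preimage)
      (λ i → f-injective (proj₂ (preimage (f i , [ i , refl ]))))
  ; edges = f-edges
  }
  where
  preimage : (v : Refinement (Vertex G) (Range f)) → Range f (value v)
  preimage (v , [ v∈range ]) = recompute (range? v) v∈range

-- The four vertices are automatically distinct, since no two vertices of P₄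
-- have the same neighbours.
no-induced-path : ExcludedMiddle a → (G : Graph a ℓ) → P₄-Free G → ∀ {p q r s} →
  Edge G p q → Edge G q r → Edge G r s →
  ¬ Edge G p r → ¬ Edge G p s → ¬ ¬ Edge G q s
no-induced-path em G free {p} {q} {r} {s} pq qr rs ¬pr ¬ps ¬qs =
  free (Range f)
    (embedding⇒≅induced P₄ G f (λ _ → em) f-injective λ i j → mk⇔ to (from i j))
  where
  f : Vertex P₄ → Vertex G
  f 0F = p
  f 1F = q
  f 2F = r
  f 3F = s

  step : ∀ {i j} → P₄-Step i j → Edge G (f i) (f j)
  step step₁₂ = pq
  step step₂₃ = qr
  step step₃₄ = rs

  to : ∀ {i j} → Edge P₄ i j → Edge G (f i) (f j)
  to (fwd ij) = step ij
  to (bwd ji) = symm G (step ji)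

  from : ∀ i j → Edge G (f i) (f j) → Edge P₄ i j
  from 0F 0F e = contradiction e (irrefl G refl)
  from 0F 1F e = fwd step₁₂
  from 0F 2F e = contradiction e ¬pr
  from 0F 3F e = contradiction e ¬ps
  from 1F 0F e = bwd step₁₂
  from 1F 1F e = contradiction e (irrefl G refl)
  from 1F 2F e = fwd step₂₃
  from 1F 3F e = contradiction e ¬qs
  from 2F 0F e = contradiction (symm G e) ¬pr
  from 2F 1F e = bwd step₂₃
  from 2F 2F e = contradiction e (irrefl G refl)
  from 2F 3F e = fwd step₃₄
  from 3F 0F e = contradiction (symm G e) ¬ps
  from 3F 1F e = contradiction (symm G e) ¬qs
  from 3F 2F e = bwd step₃₄
  from 3F 3F e = contradiction e (irrefl G refl)

  -- Consecutive vertices differ by irreflexivity; identifying two others would turn an edge of the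
  -- path into one of the excluded chords.
  f-injective : Injective _≡_ _≡_ f
  f-injective {0F} {0F} _    = refl
  f-injective {0F} {1F} p≡q  = contradiction pq (irrefl G p≡q)
  f-injective {0F} {2F} refl = contradiction rs ¬ps
  f-injective {0F} {3F} refl = contradiction (symm G pq) ¬qs
  f-injective {1F} {0F} q≡p  = contradiction pq (irrefl G (sym q≡p))
  f-injective {1F} {1F} _    = refl
  f-injective {1F} {2F} q≡r  = contradiction qr (irrefl G q≡r)
  f-injective {1F} {3F} refl = contradiction pq ¬ps
  f-injective {2F} {0F} refl = contradiction rs ¬ps
  f-injective {2F} {1F} r≡q  = contradiction qr (irrefl G (sym r≡q))
  f-injective {2F} {2F} _    = refl
  f-injective {2F} {3F} r≡s  = contradiction rs (irrefl G r≡s)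
  f-injective {3F} {0F} refl = contradiction (symm G pq) ¬qs
  f-injective {3F} {1F} refl = contradiction pq ¬ps
  f-injective {3F} {2F} s≡r  = contradiction rs (irrefl G (sym s≡r))
  f-injective {3F} {3F} _    = refl

-- Since v may equal x or u, this is the ball of radius 2 around x in the
-- complement.
CoBall₂ : (G : Graph a ℓ) → Vertex G → Pred (Vertex G) (a ⊔ ℓ)
CoBall₂ G x u = ∃[ v ] ¬ Edge G x v × ¬ Edge G v u

-- A midpoint `v` cannot be `x`, because `y` is adjacent to `x` but not to `v`. So `v` lies in
-- `inc G x`, and `y` would have to be adjacent to it.
Nₓ⇒∉CoBall₂ : (G : Graph a ℓ) → ∀ {x y} → Nₓ G x y → ¬ CoBall₂ G x y
Nₓ⇒∉CoBall₂ G (xy , y-inc) (v , ¬xv , ¬vy) = ¬vy (symm G (y-inc v v∈inc))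
  where
  v∈inc : inc G _ v
  v∈inc (inj₁ xv)   = ¬xv xv
  v∈inc (inj₂ refl) = ¬vy xy

module _ (G : Graph a ℓ) (em : ExcludedMiddle a) (edge? : Decidable (Edge G))
         (free : P₄-Free G) where

  -- One of `u`, `w`, `v` is a midpoint between `x` and `w`: otherwise `u`, `x`, `w`, `v` in this
  -- order form an induced path in `G`.
  CoBall₂-closed : ∀ {x u w} → CoBall₂ G x u → ¬ Edge G u w → CoBall₂ G x w
  CoBall₂-closed {x} {u} {w} (v , ¬xv , ¬vu) ¬uw
    with edge? x u | edge? x w | edge? v w
  ... | no ¬xu | _      | _      = u , ¬xu , ¬uw
  ... | yes _  | no ¬xw | _      = w , ¬xw , irrefl G refl
  ... | yes _  | yes _  | no ¬vw = v , ¬xv , ¬vw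
  ... | yes xu | yes xw | yes vw =
    contradiction ¬xv
      (no-induced-path em G free (symm G xu) xw (symm G vw) ¬uw (¬vu ∘ symm G))

  CoBall₂-walk : ∀ {x u w} → CoBall₂ G x u → Star (Edge (complement G)) u w → CoBall₂ G x w
  CoBall₂-walk near ε                  = near
  CoBall₂-walk near ((_ , ¬uz) ◅ walk) = CoBall₂-walk (CoBall₂-closed near ¬uz) walk

-- A missing edge from `x` to `y`, or from `y` to some `z` in `inc G x`, would yield a complement
-- walk from `x` to `y` of length one or two.
unreachable⇒Nₓ : (G : Graph a ℓ) → Decidable (Edge G) → ∀ {x y} →
  ¬ Star (Edge (complement G)) x y → Nₓ G x y
unreachable⇒Nₓ G edge? {x} {y} ¬walk = xy , y-inc
  where
  xy : Edge G x y
  xy = decidable-stable (edge? x y) λ ¬xy →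
    ¬walk (((λ { refl → ¬walk ε }) , ¬xy) ◅ ε)

  y-inc : ∀ z → inc G x z → Edge G y z
  y-inc z z∈inc = decidable-stable (edge? y z) λ ¬yz →
    -- The walk passes through `z`, which differs from `y` because `y` is a neighbour of `x`.
    ¬walk ((z∈inc ∘ inj₂ , z∈inc ∘ inj₁) ◅ ((λ { refl → z∈inc (inj₁ xy) }) , ¬yz ∘ symm G) ◅ ε)

theorem2 : {a ℓ : Level} → ExcludedMiddle (a ⊔ ℓ) →
    (G : Graph a ℓ) → Connected G → P₄-Free G →
    (∃[ x ] Satisfiable (Nₓ G x)) ⇔ (¬ Connected (complement G))
theorem2 {a} {ℓ} em G _ free = mk⇔
  (λ (x , y , y∈Nₓ) connected → Nₓ⇒∉CoBall₂ G y∈Nₓ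
    (CoBall₂-walk G (lower-em ℓ a em) edge? free
      -- The walk starts at `x`, which is in its own ball with itself as midpoint.
      (x , irrefl G refl , irrefl G refl) (connected x y)))
  (λ ¬connected → decidable-stable em λ none →
    ¬connected λ x y → decidable-stable em λ ¬walk →
      none (x , y , unreachable⇒Nₓ G edge? ¬walk))
  where
  edge? : Decidable (Edge G)
  edge? _ _ = lower-em a ℓ em
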